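{- For all integers $m,n\geq 1$, \[p^{ed}_{od}(m,n)-p^{ed}_{od}(m,n-1)=D_e(m,n-1)+D_e(m-1,n-1)-D_o(m,n-1).\]
   Context: $\mathcal{P}^{ed}_{od}$ is the set of integer partitions such that: - all parts are distinct; - every odd part is smaller than every even part; - at least one odd part appears. For integers $m,n\ge 0$: - $p^{ed}_{od}(m,n)$ is the number of partitions of $n$ in $\mathcal{P}^{ed}_{od}$ with exactly $m$ parts; in particular $p^{ed}_{od}(m,0)=0$. - $D_o(m,n)$ is the number of partitions of $n$ into exactly $m$ distinct odd parts. - $D_e(m,n)$ is the number of partitions of $n$ into exactly $m$ distinct even parts. - By convention $D_e(0,n)=D_o(0,n)$ equals $1$ if $n=0$ and $0$ otherwise. -}

module Defs where

open import Data.List using (List; []; _∷_; [_]; _++_; map; filter; length)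
open import Data.List.Membership.Propositional using (_∈_)
open import Data.List.Membership.Propositional.Properties
  using (∈-map⁺; ∈-map⁻; ∈-++⁺ˡ; ∈-++⁺ʳ; ∈-++⁻; ∈-filter⁺; ∈-filter⁻)
open import Data.List.Properties using (∷-injectiveʳ)
open import Data.List.Relation.Unary.All using (All; []; _∷_; all?)
open import Data.List.Relation.Unary.AllPairs using ([]; _∷_)
open import Data.List.Relation.Unary.Any using (Any; here; there; any?)
open import Data.List.Relation.Unary.Linked using (Linked; linked?)
open import Data.List.Relation.Unary.Unique.Propositional using (Unique)
import Data.List.Relation.Unary.Unique.Propositional.Properties as Uniqueₚ
open import Data.Nat using (ℕ; zero; suc; _+_; _≤_; _<_; _≥_; z≤n; s≤s; _≟_; _<?_; _≥?_)
open import Data.Nat.ListAction using (sum)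
open import Data.Nat.Divisibility using (_∣_; _∣?_)
open import Data.Nat.Properties
  using (≤-refl; ≤-trans; n≤1+n; 1+n≰n; +-suc; +-identityʳ; m≤n⇒m<n∨m≡n;
         ≤-antisym; ≤-reflexive; +-cancelˡ-≡; m≤m+n)
open import Data.List.Relation.Unary.Unique.DecPropositional _≟_ using (unique?)
open import Data.Product using (_×_; _,_; ∃)
open import Data.Sum using (inj₁; inj₂)
open import Function.Bundles using (_⇔_; mk⇔)
open import Level using (0ℓ)
open import Relation.Binary.PropositionalEquality using (_≡_; refl; sym; trans; cong)
open import Relation.Nullary using (¬_; ¬?; _×-dec_; _→-dec_; contradiction)
open import Relation.Unary using (Pred; Decidable)

Even Odd : Pred ℕ 0ℓ
Even k = 2 ∣ k
Odd  k = ¬ Even k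

even? : Decidable Even
even? k = 2 ∣? k

odd? : Decidable Odd
odd? k = ¬? (even? k)

-- A partition is the weakly decreasing list of its parts.
record IsPartition (n : ℕ) (parts : List ℕ) : Set where
  constructor isPartition
  field
    decreasing : Linked _≥_ parts
    positive   : All (1 ≤_) parts
    sums-to    : sum parts ≡ n

-- compositionsFrom a n lists the lists of positive integers of sum a + n
-- whose head is at least a, for a ≥ 1.
compositionsFrom : ℕ → ℕ → List (List ℕ)
compositionsFrom a zero    = [ [ a ] ]
compositionsFrom a (suc n) = map (a ∷_) (compositionsFrom 1 n) ++ compositionsFrom (suc a) n

compositions : ℕ → List (List ℕ)
compositions zero    = [ [] ]
compositions (suc n) = compositionsFrom 1 n

-- That this lists every partition of n exactly once is proved below
-- (∈-partitions and partitions-unique).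
partitions : ℕ → List (List ℕ)
partitions n = filter (linked? _≥?_) (compositions n)

count : {P : Pred (List ℕ) 0ℓ} → Decidable P → ℕ → ℕ → ℕ
count P? m n = length (filter (λ parts → (length parts ≟ m) ×-dec P? parts) (partitions n))

OddsBelowEvens : Pred (List ℕ) 0ℓ
OddsBelowEvens parts = All (λ x → All (λ y → Odd x → Even y → x < y) parts) parts

oddsBelowEvens? : Decidable OddsBelowEvens
oddsBelowEvens? parts =
  all? (λ x → all? (λ y → odd? x →-dec (even? y →-dec (x <? y))) parts) parts

𝒫ᵉᵈₒd : Pred (List ℕ) 0ℓ
𝒫ᵉᵈₒd parts = Unique parts × OddsBelowEvens parts × Any Odd parts

𝒫ᵉᵈₒd? : Decidable 𝒫ᵉᵈₒd
𝒫ᵉᵈₒd? parts = unique? parts ×-dec (oddsBelowEvens? parts ×-dec any? odd? parts)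

DistinctOdd DistinctEven : Pred (List ℕ) 0ℓ
DistinctOdd  parts = Unique parts × All Odd parts
DistinctEven parts = Unique parts × All Even parts

distinctOdd? : Decidable DistinctOdd
distinctOdd? parts = unique? parts ×-dec all? odd? parts

distinctEven? : Decidable DistinctEven
distinctEven? parts = unique? parts ×-dec all? even? parts

pᵉᵈₒd Dₒ Dₑ : ℕ → ℕ → ℕ
pᵉᵈₒd = count 𝒫ᵉᵈₒd?
Dₒ    = count distinctOdd?
Dₑ    = count distinctEven?

private
  sum≡0⇒[] : ∀ {xs} → All (1 ≤_) xs → sum xs ≡ 0 → xs ≡ []
  sum≡0⇒[] []           _  = refl
  sum≡0⇒[] (s≤s _ ∷ _) ()

  compositionsFrom-sound : ∀ a n {xs} → 1 ≤ a → xs ∈ compositionsFrom a n →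
                           All (1 ≤_) xs × sum xs ≡ a + n
  compositionsFrom-sound a zero    1≤a (here refl) = 1≤a ∷ [] , refl
  compositionsFrom-sound a (suc n) 1≤a xs∈
    with ∈-++⁻ (map (a ∷_) (compositionsFrom 1 n)) xs∈
  ... | inj₁ xs∈ˡ with ∈-map⁻ (a ∷_) xs∈ˡ
  ...   | ys , ys∈ , refl with compositionsFrom-sound 1 n ≤-refl ys∈
  ...     | pos , eq = 1≤a ∷ pos , cong (a +_) eq
  compositionsFrom-sound a (suc n) 1≤a xs∈
      | inj₂ xs∈ʳ with compositionsFrom-sound (suc a) n (s≤s z≤n) xs∈ʳ
  ...   | pos , eq = pos , trans eq (sym (+-suc a n))

  head≡ : ∀ {a x n} xs → a ≤ x → x + sum xs ≡ a + n → n ≡ 0 → x ≡ a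
  head≡ {a} {x} xs a≤x eq refl =
    ≤-antisym (≤-trans (m≤m+n x (sum xs)) (≤-reflexive (trans eq (+-identityʳ a)))) a≤x

  compositionsFrom-complete : ∀ a n {x xs} → a ≤ x → All (1 ≤_) xs → x + sum xs ≡ a + n →
                              x ∷ xs ∈ compositionsFrom a n
  compositionsFrom-complete a zero {x} {xs} a≤x pos eq with head≡ xs a≤x eq refl
  ... | refl with sum≡0⇒[] pos (+-cancelˡ-≡ a _ _ eq)
  ...   | refl = here refl
  compositionsFrom-complete a (suc n) {x} {xs} a≤x pos eq with m≤n⇒m<n∨m≡n a≤x
  ... | inj₁ a<x = ∈-++⁺ʳ (map (a ∷_) (compositionsFrom 1 n))
                     (compositionsFrom-complete (suc a) n a<x pos (trans eq (+-suc a n)))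
  ... | inj₂ refl with xs | pos | +-cancelˡ-≡ a _ _ eq
  ...   | y ∷ ys | 1≤y ∷ pos′ | eq′ =
            ∈-++⁺ˡ (∈-map⁺ (a ∷_) (compositionsFrom-complete 1 n 1≤y pos′ eq′))

  compositionsFrom-head : ∀ a n {x xs} → x ∷ xs ∈ compositionsFrom a n → a ≤ x
  compositionsFrom-head a zero    (here refl) = ≤-refl
  compositionsFrom-head a (suc n) xs∈ with ∈-++⁻ (map (a ∷_) (compositionsFrom 1 n)) xs∈
  ... | inj₁ xs∈ˡ with ∈-map⁻ (a ∷_) xs∈ˡ
  ...   | _ , _ , refl = ≤-refl
  compositionsFrom-head a (suc n) xs∈ | inj₂ xs∈ʳ =
    ≤-trans (n≤1+n a) (compositionsFrom-head (suc a) n xs∈ʳ)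

  compositionsFrom-unique : ∀ a n → Unique (compositionsFrom a n)
  compositionsFrom-unique a zero    = [] ∷ []
  compositionsFrom-unique a (suc n) =
    Uniqueₚ.++⁺ (Uniqueₚ.map⁺ ∷-injectiveʳ (compositionsFrom-unique 1 n))
                (compositionsFrom-unique (suc a) n)
                λ { (∈ˡ , ∈ʳ) → disjoint (∈-map⁻ (a ∷_) ∈ˡ) ∈ʳ }
    where
    disjoint : ∀ {zs} → (∃ λ ys → ys ∈ compositionsFrom 1 n × zs ≡ a ∷ ys) →
               ¬ zs ∈ compositionsFrom (suc a) n
    disjoint (_ , _ , refl) ∈ʳ = 1+n≰n (compositionsFrom-head (suc a) n ∈ʳ)

  compositions-sound : ∀ n {xs} → xs ∈ compositions n → All (1 ≤_) xs × sum xs ≡ n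
  compositions-sound zero    (here refl) = [] , refl
  compositions-sound (suc n) xs∈         = compositionsFrom-sound 1 n ≤-refl xs∈

  compositions-complete : ∀ n {xs} → All (1 ≤_) xs → sum xs ≡ n → xs ∈ compositions n
  compositions-complete zero    pos         eq with sum≡0⇒[] pos eq
  ... | refl = here refl
  compositions-complete (suc n) (1≤x ∷ pos) eq = compositionsFrom-complete 1 n 1≤x pos eq

  compositions-unique : ∀ n → Unique (compositions n)
  compositions-unique zero    = [] ∷ []
  compositions-unique (suc n) = compositionsFrom-unique 1 n

∈-partitions : ∀ {n parts} → parts ∈ partitions n ⇔ IsPartition n parts
∈-partitions {n} = mk⇔ to from
  where
  to : ∀ {parts} → parts ∈ partitions n → IsPartition n parts
  to parts∈ with ∈-filter⁻ (linked? _≥?_) {xs = compositions n} parts∈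
  ... | comp∈ , dec with compositions-sound n comp∈
  ...   | pos , eq = isPartition dec pos eq

  from : ∀ {parts} → IsPartition n parts → parts ∈ partitions n
  from (isPartition dec pos eq) =
    ∈-filter⁺ (linked? _≥?_) (compositions-complete n pos eq) dec

partitions-unique : ∀ n → Unique (partitions n)
partitions-unique n = Uniqueₚ.filter⁺ (linked? _≥?_) (compositions-unique n)

{-# OPTIONS --safe #-}

-- Lowering the largest odd part of a partition of n in 𝒫ᵉᵈₒd by one turns it into the smallest
-- even part, so the parts stay distinct with the odd ones below the even ones, and raising
-- the smallest even part undoes this.  The image consists of the partitions of n - 1 of this
-- shape with at least one even part, where the even part 0 is allowed: those with m positive
-- even parts, those with m - 1 positive even parts and a part 0, and those with both
-- parities.  The latter are the members of 𝒫ᵉᵈₒd that do not consist of odd parts only.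

module Submission where

open import Defs
open import Data.Nat using (ℕ; _∸_; _≥_)
open import Data.Integer using (+_; _+_; _-_)
open import Relation.Binary.PropositionalEquality using (_≡_)

open import Data.Integer.Tactic.RingSolver using (solve-∀)
open import Data.List using (List; []; _∷_; _∷ʳ_; _++_; map; filter; length)
open import Data.List.Membership.Propositional using (_∈_)
open import Data.List.Membership.Propositional.Properties
  using (∈-∃++; ∈-AllPairs₂; ∈-filter⁺; ∈-filter⁻; ∈-++⁺ˡ; ∈-++⁺ʳ; ∈-++⁻; ∈-map⁺; ∈-map⁻)
open import Data.List.Properties using (length-++; length-map; ∷ʳ-injectiveˡ)
open import Data.List.Relation.Binary.Permutation.Propositional.Properties
  using (shift; ↭-length; ∈-resp-↭)
open import Data.List.Relation.Unary.All using (All; []; _∷_)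
import Data.List.Relation.Unary.All as All
open import Data.List.Relation.Unary.All.Properties using (All¬⇒¬Any)
import Data.List.Relation.Unary.All.Properties as Allₚ
open import Data.List.Relation.Unary.AllPairs using (AllPairs; []; _∷_)
import Data.List.Relation.Unary.AllPairs as AllPairs
import Data.List.Relation.Unary.AllPairs.Properties as AllPairsₚ
open import Data.List.Relation.Unary.Any using (Any; here; there)
open import Data.List.Relation.Unary.Linked.Properties using (Linked⇒AllPairs; AllPairs⇒Linked)
open import Data.List.Relation.Unary.Unique.Propositional using (Unique)
import Data.List.Relation.Unary.Unique.Propositional.Properties as Uniqueₚ
import Data.Nat as ℕ
open import Data.Nat using (zero; suc; _≤_; _<_; _>_; z≤n; s≤s; z<s; _≟_)
open import Data.Nat.Divisibility using (_∣0; ∣1⇒≡1; ∣m+n∣m⇒∣n; ∣m∣n⇒∣m+n; ∣-refl)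
open import Data.Nat.ListAction using (sum)
open import Data.Nat.ListAction.Properties using (sum-++)
open import Data.Nat.Properties
  using (≤-trans; ≤-reflexive; ≤-antisym; ≤∧≢⇒<; <-asym; <-trans; <⇒≤; <⇒≢; n<1+n;
         m<n⇒m<1+n; +-comm; +-suc; +-identityʳ; suc-injective; 1+n≢n)
open import Data.Product using (_×_; _,_; ∃; proj₁; proj₂)
open import Data.Sum using (_⊎_; inj₁; inj₂)
open import Function using (_∘_; flip)
open import Function.Bundles using (Equivalence)
open import Level using (0ℓ)
open import Relation.Binary.Core using (Rel)
open import Relation.Binary.PropositionalEquality
  using (_≢_; refl; sym; trans; cong; subst; ≢-sym; module ≡-Reasoning)
open import Relation.Nullary using (¬_; yes; no; contradiction; _×-dec_)
open import Relation.Nullary.Decidable using (decidable-stable)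
open import Relation.Unary using (Pred; Decidable)

-- Counting along a relation

module _ {A : Set} where

  -- Induction on `xs`: delete the partner `y` of the head from `ys`. By injectivity no other entry
  -- of `xs` is related to `y`, so their partners survive the deletion.
  relation⇒length≤ : ∀ {R : Rel A 0ℓ} {xs ys} → Unique xs →
                     (∀ {x} → x ∈ xs → ∃ λ y → y ∈ ys × R x y) →
                     (∀ {x x′ y} → R x y → R x′ y → x ≡ x′) →
                     length xs ≤ length ys
  relation⇒length≤ [] total injective = z≤n
  relation⇒length≤ {R} {x ∷ xs} (x∉xs ∷ xs!) total injective
    with y , y∈ys , xRy ← total (here refl)
    with ys₁ , ys₂ , refl ← ∈-∃++ y∈ys =
    ≤-trans (s≤s (relation⇒length≤ xs! total′ injective))
            (≤-reflexive (sym (↭-length (shift y ys₁ ys₂))))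
    where
    total′ : ∀ {x′} → x′ ∈ xs → ∃ λ y′ → y′ ∈ ys₁ ++ ys₂ × R x′ y′
    total′ x′∈xs with total (there x′∈xs)
    ... | y′ , y′∈ys , x′Ry′ with ∈-resp-↭ (shift y ys₁ ys₂) y′∈ys
    ...   | here refl = contradiction (injective xRy x′Ry′) (All.lookup x∉xs x′∈xs)
    ...   | there y′∈ = y′ , y′∈ , x′Ry′

  bijectiveRelation⇒length≡ : ∀ {R : Rel A 0ℓ} {xs ys} → Unique xs → Unique ys →
                              (∀ {x} → x ∈ xs → ∃ λ y → y ∈ ys × R x y) →
                              (∀ {y} → y ∈ ys → ∃ λ x → x ∈ xs × R x y) →
                              (∀ {x x′ y} → R x y → R x′ y → x ≡ x′) →
                              (∀ {x y y′} → R x y → R x y′ → y ≡ y′) →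
                              length xs ≡ length ys
  bijectiveRelation⇒length≡ {R} xs! ys! total surjective injective functional =
    ≤-antisym (relation⇒length≤ {R} xs! total injective)
              (relation⇒length≤ {flip R} ys! surjective functional)

-- Parity

even⇒odd-suc : ∀ {n} → Even n → Odd (suc n)
even⇒odd-suc {n} 2∣n 2∣1+n
  with () ← ∣1⇒≡1 (∣m+n∣m⇒∣n (subst Even (+-comm 1 n) 2∣1+n) 2∣n)

odd-suc⇒even : ∀ {n} → Odd (suc n) → Even n
odd-suc⇒even {zero}  _ = 2 ∣0
-- If `suc n` were odd, `n` would be even by induction, and then so would `2 + n`, against the
-- hypothesis.
odd-suc⇒even {suc n} odd = decidable-stable (even? (suc n)) λ odd′ →
  odd (∣m∣n⇒∣m+n ∣-refl (odd-suc⇒even odd′))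

even-<⇒suc< : ∀ {m n} → Even m → Even n → m < n → suc m < n
even-<⇒suc< 2∣m 2∣n m<n = ≤∧≢⇒< m<n λ { refl → even⇒odd-suc 2∣m 2∣n }

odd⇒positive : ∀ {n} → Odd n → 1 ≤ n
odd⇒positive {zero}  odd = contradiction (2 ∣0) odd
odd⇒positive {suc n} _   = z<s

-- Partitions whose even parts precede the odd ones

infix 4 _▷_
-- Required of each entry against all later ones, this says that the list strictly decreases and
-- that no even entry follows an odd one. The entry 0 is permitted, since lowering an odd part 1
-- produces it.
_▷_ : Rel ℕ 0ℓ
x ▷ y = x > y × (Even y → Even x)

all-▷⇒even : ∀ {x ys} → All (x ▷_) ys → Any Even ys → Even x
all-▷⇒even ((_ , e) ∷ _)  (here even)  = e even
all-▷⇒even (_ ∷ x▷)       (there any)  = all-▷⇒even x▷ any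

even⇒all-▷ : ∀ {x ys} → Even x → All (_< x) ys → All (x ▷_) ys
even⇒all-▷ even = All.map λ y<x → y<x , λ _ → even

odd⇒all-odd : ∀ {x ys} → Odd x → All (x ▷_) ys → All Odd ys
odd⇒all-odd odd = All.map λ x▷y even → odd (proj₂ x▷y even)

-- What the members of all three families share; the families differ only in a further parity
-- condition.
record Layered (m n : ℕ) (parts : List ℕ) : Set where
  constructor layered
  field
    ordered   : AllPairs _▷_ parts
    positive  : All (1 ≤_) parts
    sums-to   : sum parts ≡ n
    of-length : length parts ≡ m

≥∧unique∧oddsBelow⇒▷ : ∀ {xs} → AllPairs _≥_ xs → Unique xs → OddsBelowEvens xs → AllPairs _▷_ xs
≥∧unique∧oddsBelow⇒▷ []         []         _ = []
≥∧unique∧oddsBelow⇒▷ {x ∷ xs} (x≥ ∷ xs≥) (x≢ ∷ xs!) ((_ ∷ below) ∷ belows) =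
  All.zipWith step (All.zip (x≥ , x≢) , below) ∷
  ≥∧unique∧oddsBelow⇒▷ xs≥ xs! (All.map All.tail belows)
  where
  step : ∀ {y} → (x ≥ y × x ≢ y) × (Odd x → Even y → x < y) → x ▷ y
  step ((x≥y , x≢y) , x<y) =
    y<x , λ even → decidable-stable (even? x) λ odd → <-asym y<x (x<y odd even)
    where y<x = ≤∧≢⇒< x≥y (≢-sym x≢y)

▷⇒oddsBelowEvens : ∀ {xs} → AllPairs _▷_ xs → OddsBelowEvens xs
▷⇒oddsBelowEvens {xs} xs▷ = All.tabulate λ x∈ → All.tabulate λ y∈ → below x∈ y∈
  where
  below : ∀ {x y} → x ∈ xs → y ∈ xs → Odd x → Even y → x < y
  -- Either the two entries coincide, or `x` comes first, or `y` comes first; parity excludes the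
  -- first two cases.
  below x∈ y∈ odd even with ∈-AllPairs₂ xs▷ x∈ y∈
  ... | inj₁ refl             = contradiction even odd
  ... | inj₂ (inj₁ (_ , e))   = contradiction (e even) odd
  ... | inj₂ (inj₂ (x<y , _)) = x<y

allOdd⇒oddsBelowEvens : ∀ {xs} → All Odd xs → OddsBelowEvens xs
allOdd⇒oddsBelowEvens odds =
  All.map (λ _ → All.map (λ odd _ even → contradiction even odd) odds) odds

allEven⇒oddsBelowEvens : ∀ {xs} → All Even xs → OddsBelowEvens xs
allEven⇒oddsBelowEvens evens =
  All.map (λ even → All.map (λ _ odd _ → contradiction even odd) evens) evens

-- Membership in the lists that are counted

listing : {P : Pred (List ℕ) 0ℓ} → Decidable P → ℕ → ℕ → List (List ℕ)
listing P? m n = filter (λ parts → (length parts ≟ m) ×-dec P? parts) (partitions n)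

module _ {P : Pred (List ℕ) 0ℓ} (P? : Decidable P) where

  listing-unique : ∀ m n → Unique (listing P? m n)
  listing-unique m n = Uniqueₚ.filter⁺ _ (partitions-unique n)

  ∈-listing⁻ : (∀ {xs} → P xs → Unique xs × OddsBelowEvens xs) →
               ∀ {m n xs} → xs ∈ listing P? m n → Layered m n xs × P xs
  ∈-listing⁻ P⇒ {n = n} xs∈
    with xs∈′ , len , p ← ∈-filter⁻ _ {xs = partitions n} xs∈
    with isPartition dec pos s ← Equivalence.to ∈-partitions xs∈′
    with unique , below ← P⇒ p =
    layered (≥∧unique∧oddsBelow⇒▷ (Linked⇒AllPairs (flip ≤-trans) dec) unique below) pos s len , p

  ∈-listing⁺ : ∀ {m n xs} → Layered m n xs →
               (Unique xs → OddsBelowEvens xs → P xs) → xs ∈ listing P? m n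
  ∈-listing⁺ (layered xs▷ pos s len) ⇒P =
    ∈-filter⁺ _
      (Equivalence.from ∈-partitions
        (isPartition (AllPairs⇒Linked (AllPairs.map (<⇒≤ ∘ proj₁) xs▷)) pos s))
      (len , ⇒P (AllPairs.map (≢-sym ∘ <⇒≢ ∘ proj₁) xs▷) (▷⇒oddsBelowEvens xs▷))

∈-𝒫⁻ : ∀ {m n xs} → xs ∈ listing 𝒫ᵉᵈₒd? m n → Layered m n xs × Any Odd xs
∈-𝒫⁻ xs∈ with l , _ , _ , odd ← ∈-listing⁻ 𝒫ᵉᵈₒd? (λ (u , b , _) → u , b) xs∈ = l , odd

∈-Dₒ⁻ : ∀ {m n xs} → xs ∈ listing distinctOdd? m n → Layered m n xs × All Odd xs
∈-Dₒ⁻ xs∈ with l , _ , odd ← ∈-listing⁻ distinctOdd? (λ (u , o) → u , allOdd⇒oddsBelowEvens o) xs∈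
  = l , odd

∈-Dₑ⁻ : ∀ {m n xs} → xs ∈ listing distinctEven? m n → Layered m n xs × All Even xs
∈-Dₑ⁻ xs∈ with l , _ , even ← ∈-listing⁻ distinctEven? (λ (u , e) → u , allEven⇒oddsBelowEvens e) xs∈
  = l , even

∈-𝒫⁺ : ∀ {m n xs} → Layered m n xs → Any Odd xs → xs ∈ listing 𝒫ᵉᵈₒd? m n
∈-𝒫⁺ l odd = ∈-listing⁺ 𝒫ᵉᵈₒd? l λ u b → u , b , odd

∈-Dₒ⁺ : ∀ {m n xs} → Layered m n xs → All Odd xs → xs ∈ listing distinctOdd? m n
∈-Dₒ⁺ l odd = ∈-listing⁺ distinctOdd? l λ u _ → u , odd

∈-Dₑ⁺ : ∀ {m n xs} → Layered m n xs → All Even xs → xs ∈ listing distinctEven? m n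
∈-Dₑ⁺ l even = ∈-listing⁺ distinctEven? l λ u _ → u , even

all⇒any : ∀ {P : Pred ℕ 0ℓ} {m xs} → length xs ≡ suc m → All P xs → Any P xs
all⇒any _ (p ∷ _) = here p

-- Entries before an odd one exceed it and entries after it are odd, so 0 cannot occur. Hence
-- raising an even part, possibly 0, yields a genuine partition.
anyOdd⇒positive : ∀ {xs} → AllPairs _▷_ xs → Any Odd xs → All (1 ≤_) xs
anyOdd⇒positive (x▷ ∷ _) (here odd) =
  odd⇒positive odd ∷ All.map odd⇒positive (odd⇒all-odd odd x▷)
anyOdd⇒positive ((x▷y ∷ _) ∷ xs▷@(_ ∷ _)) (there odd) =
  ≤-trans (s≤s z≤n) (proj₁ x▷y) ∷ anyOdd⇒positive xs▷ odd

-- Lowering the largest odd part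

-- The odd tail in `here` makes `suc x` the largest odd part on the left when the list decreases,
-- and `x` the last even entry on the right. The relation thus describes lowering and raising alike.
data Lowers : Rel (List ℕ) 0ℓ where
  here  : ∀ {x xs} → Even x → All Odd xs → Lowers (suc x ∷ xs) (x ∷ xs)
  there : ∀ {x xs ys} → Even x → Lowers xs ys → Lowers (x ∷ xs) (x ∷ ys)

lowers⇒anyEven : ∀ {xs ys} → Lowers xs ys → Any Even ys
lowers⇒anyEven (here even _)  = here even
lowers⇒anyEven (there even _) = here even

lowers⇒anyOdd : ∀ {xs ys} → Lowers xs ys → Any Odd xs
lowers⇒anyOdd (here even _) = here (even⇒odd-suc even)
lowers⇒anyOdd (there _ l)   = there (lowers⇒anyOdd l)

lowers-sum : ∀ {xs ys} → Lowers xs ys → sum xs ≡ suc (sum ys)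
lowers-sum (here _ _)       = refl
lowers-sum (there {x} _ l) = trans (cong (x ℕ.+_) (lowers-sum l)) (+-suc x _)

lowers-length : ∀ {xs ys} → Lowers xs ys → length xs ≡ length ys
lowers-length (here _ _)  = refl
lowers-length (there _ l) = cong suc (lowers-length l)

lowers-injective : ∀ {xs xs′ ys} → Lowers xs ys → Lowers xs′ ys → xs ≡ xs′
-- Mixed cases fail: `here` makes the tail odd, while `there` puts an even entry in it.
lowers-injective (here _ _)    (here _ _)    = refl
lowers-injective (here _ odds) (there _ l)   = contradiction (lowers⇒anyEven l) (All¬⇒¬Any odds)
lowers-injective (there _ l)   (here _ odds) = contradiction (lowers⇒anyEven l) (All¬⇒¬Any odds)
lowers-injective (there _ l)   (there _ l′)  = cong (_ ∷_) (lowers-injective l l′)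

lowers-functional : ∀ {xs ys ys′} → Lowers xs ys → Lowers xs ys′ → ys ≡ ys′
lowers-functional (here _ _)    (here _ _)     = refl
-- The head on the left is odd in `here` and even in `there`.
lowers-functional (here even _) (there even′ _) = contradiction even′ (even⇒odd-suc even)
lowers-functional (there even′ _) (here even _) = contradiction even′ (even⇒odd-suc even)
lowers-functional (there _ l)   (there _ l′)   = cong (_ ∷_) (lowers-functional l l′)

lowers-below : ∀ {z xs ys} → Lowers xs ys → All (_< z) xs → All (_< z) ys
lowers-below (here _ _)  (x< ∷ xs<) = <-trans (n<1+n _) x< ∷ xs<
lowers-below (there _ l) (x< ∷ xs<) = x< ∷ lowers-below l xs<

-- The raised entry becomes odd, so it cannot reach the even bound `z`.
raises-below : ∀ {z xs ys} → Even z → Lowers xs ys → All (_< z) ys → All (_< z) xs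
raises-below even (here even′ _) (x< ∷ xs<) = even-<⇒suc< even′ even x< ∷ xs<
raises-below even (there _ l)    (x< ∷ xs<) = x< ∷ raises-below even l xs<

lower : ∀ {xs} → AllPairs _▷_ xs → Any Odd xs → ∃ λ ys → Lowers xs ys × AllPairs _▷_ ys
lower {x ∷ xs} (x▷ ∷ xs▷) odd with even? x
lower {x ∷ xs} (x▷ ∷ xs▷) (here odd) | yes even = contradiction even odd
lower {x ∷ xs} (x▷ ∷ xs▷) (there odd) | yes even with lower xs▷ odd
... | ys , l , ys▷ =
  x ∷ ys , there even l , even⇒all-▷ even (lowers-below l (All.map proj₁ x▷)) ∷ ys▷
lower {zero  ∷ xs} _ _ | no odd = contradiction (2 ∣0) odd
lower {suc x ∷ xs} (x▷ ∷ xs▷) _ | no odd =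
  x ∷ xs , here even odds , even⇒all-▷ even (All.zipWith below (x▷ , odds)) ∷ xs▷
  where
  even = odd-suc⇒even odd
  odds = odd⇒all-odd odd x▷
  -- A later odd part may be at most `x`, but equality is impossible because `x` is even; the
  -- lowered part stays distinct.
  below : ∀ {y} → suc x ▷ y × Odd y → y < x
  below ((s≤s y≤x , _) , odd′) = ≤∧≢⇒< y≤x λ { refl → odd′ even }

raise : ∀ {ys} → AllPairs _▷_ ys → Any Even ys → ∃ λ xs → Lowers xs ys × AllPairs _▷_ xs
-- The entry to raise is the last even one, so the search decides whether an even entry remains in
-- the tail.
raise {y ∷ ys} (y▷ ∷ ys▷) even with All.search even? ys
raise {y ∷ ys} (y▷ ∷ ys▷) even | inj₂ even′ with raise ys▷ even′
... | xs , l , xs▷ =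
  y ∷ xs , there evenʸ l , even⇒all-▷ evenʸ (raises-below evenʸ l (All.map proj₁ y▷)) ∷ xs▷
  where evenʸ = all-▷⇒even y▷ even′
raise {y ∷ ys} (y▷ ∷ ys▷) (there even) | inj₁ odds = contradiction even (All¬⇒¬Any odds)
raise {y ∷ ys} (y▷ ∷ ys▷) (here even)  | inj₁ odds =
  suc y ∷ ys , here even odds ,
  All.zipWith (λ (y▷z , odd) → m<n⇒m<1+n (proj₁ y▷z) , λ even′ → contradiction even′ odd)
              (y▷ , odds) ∷ ys▷

-- The part 0

-- In a strictly decreasing list 0 can only come last, and, being even, it forces every entry before
-- it to be even.
▷-positive-or-zero : ∀ {xs} → AllPairs _▷_ xs →
                     All (1 ≤_) xs ⊎
                     ∃ λ zs → xs ≡ zs ∷ʳ 0 × All (1 ≤_) zs × All Even zs × AllPairs _▷_ zs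
▷-positive-or-zero [] = inj₁ []
▷-positive-or-zero {zero ∷ []} (_ ∷ _) = inj₂ ([] , refl , [] , [] , [])
▷-positive-or-zero {zero ∷ _ ∷ _} (((() , _) ∷ _) ∷ _)
▷-positive-or-zero {suc x ∷ xs} (x▷ ∷ xs▷) with ▷-positive-or-zero xs▷
... | inj₁ pos = inj₁ (z<s ∷ pos)
... | inj₂ (zs , refl , pos , evens , zs▷) with Allₚ.∷ʳ⁻ x▷
...   | x▷zs , x▷0 = inj₂ (suc x ∷ zs , refl , z<s ∷ pos , proj₂ x▷0 (2 ∣0) ∷ evens , x▷zs ∷ zs▷)

∷ʳ0-▷ : ∀ {xs} → AllPairs _▷_ xs → All (1 ≤_) xs → All Even xs → AllPairs _▷_ (xs ∷ʳ 0)
∷ʳ0-▷ xs▷ pos evens =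
  AllPairsₚ.++⁺ xs▷ ([] ∷ []) (All.zipWith (λ (p , e) → (p , λ _ → e) ∷ []) (pos , evens))

sum-∷ʳ0 : ∀ xs → sum (xs ∷ʳ 0) ≡ sum xs
sum-∷ʳ0 xs = trans (sum-++ xs _) (+-identityʳ _)

length-∷ʳ : ∀ (xs : List ℕ) {x} → length (xs ∷ʳ x) ≡ suc (length xs)
length-∷ʳ xs = trans (length-++ xs) (+-comm _ 1)

-- The bijection

-- The partitions into odd parts are not reached by lowering; matching each with itself
-- brings Dₒ to the left-hand side and avoids a subtraction.
data Matches (n : ℕ) : Rel (List ℕ) 0ℓ where
  lowered : ∀ {xs ys} → sum xs ≡ suc n → Lowers xs ys → Matches n xs ys
  kept    : ∀ {xs} → sum xs ≡ n → All Odd xs → Matches n xs xs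

matches-injective : ∀ {n xs xs′ ys} → Matches n xs ys → Matches n xs′ ys → xs ≡ xs′
matches-injective (lowered _ l) (lowered _ l′) = lowers-injective l l′
-- A lowered list contains an even entry, a kept one does not.
matches-injective (lowered _ l) (kept _ odds)  = contradiction (lowers⇒anyEven l) (All¬⇒¬Any odds)
matches-injective (kept _ odds) (lowered _ l)  = contradiction (lowers⇒anyEven l) (All¬⇒¬Any odds)
matches-injective (kept _ _)    (kept _ _)     = refl

matches-functional : ∀ {n xs ys ys′} → Matches n xs ys → Matches n xs ys′ → ys ≡ ys′
matches-functional (lowered _ l) (lowered _ l′) = lowers-functional l l′
-- On the left the two kinds are told apart by their sums, `suc n` and `n`.
matches-functional (lowered s _) (kept s′ _)    = contradiction (trans (sym s) s′) 1+n≢n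
matches-functional (kept s′ _)   (lowered s _)  = contradiction (trans (sym s) s′) 1+n≢n
matches-functional (kept _ _)    (kept _ _)     = refl

module _ (m n : ℕ) where

  -- The two sides of the identity with the subtracted terms moved across; `m` and `n` stand for the
  -- theorem's m - 1 and n - 1. The appended 0 raises the number of parts from `m` to `suc m`.
  sources evens∷ʳ0 targets : List (List ℕ)
  sources  = listing 𝒫ᵉᵈₒd? (suc m) (suc n) ++ listing distinctOdd? (suc m) n
  evens∷ʳ0 = map (_∷ʳ 0) (listing distinctEven? m n)
  targets  = listing distinctEven? (suc m) n ++ evens∷ʳ0 ++ listing 𝒫ᵉᵈₒd? (suc m) n

  sources-unique : Unique sources
  sources-unique =
    Uniqueₚ.++⁺ (listing-unique 𝒫ᵉᵈₒd? (suc m) (suc n)) (listing-unique distinctOdd? (suc m) n)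
      λ (∈ˡ , ∈ʳ) → 1+n≢n (trans (sym (Layered.sums-to (proj₁ (∈-𝒫⁻ {suc m} {suc n} ∈ˡ))))
                                  (Layered.sums-to (proj₁ (∈-Dₒ⁻ {suc m} {n} ∈ʳ))))

  evens∷ʳ0-not-positive : ∀ {xs} → xs ∈ evens∷ʳ0 → ¬ All (1 ≤_) xs
  evens∷ʳ0-not-positive xs∈ pos with _ , _ , refl ← ∈-map⁻ (_∷ʳ 0) xs∈
    with () ← proj₂ (Allₚ.∷ʳ⁻ pos)

  -- The middle lists contain 0 and the others do not; the outer two families are separated by the
  -- presence of an odd part.
  targets-unique : Unique targets
  targets-unique =
    Uniqueₚ.++⁺ (listing-unique distinctEven? (suc m) n)
      (Uniqueₚ.++⁺ (Uniqueₚ.map⁺ (λ {xs} {ys} → ∷ʳ-injectiveˡ xs ys)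
                                 (listing-unique distinctEven? m n))
                   (listing-unique 𝒫ᵉᵈₒd? (suc m) n)
                   λ (∈ˡ , ∈ʳ) → evens∷ʳ0-not-positive ∈ˡ
                     (Layered.positive (proj₁ (∈-𝒫⁻ {suc m} {n} ∈ʳ))))
      disjoint
    where
    disjoint : ∀ {xs} → ¬ (xs ∈ listing distinctEven? (suc m) n ×
                           xs ∈ evens∷ʳ0 ++ listing 𝒫ᵉᵈₒd? (suc m) n)
    disjoint (∈ˡ , ∈ʳ) with ∈-Dₑ⁻ {suc m} {n} ∈ˡ | ∈-++⁻ evens∷ʳ0 ∈ʳ
    ... | l , _     | inj₁ ∈₀ = evens∷ʳ0-not-positive ∈₀ (Layered.positive l)
    ... | _ , evens | inj₂ ∈𝒫 =
      All¬⇒¬Any (All.map contradiction evens) (proj₂ (∈-𝒫⁻ {suc m} {n} ∈𝒫))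

  lowered∈targets : ∀ {ys} → AllPairs _▷_ ys → sum ys ≡ n → length ys ≡ suc m → ys ∈ targets
  lowered∈targets {ys} ys▷ s len with ▷-positive-or-zero ys▷
  ... | inj₂ (zs , refl , pos , evens , zs▷) =
    ∈-++⁺ʳ (listing distinctEven? (suc m) n) (∈-++⁺ˡ (∈-map⁺ (_∷ʳ 0) (∈-Dₑ⁺
      (layered zs▷ pos (trans (sym (sum-∷ʳ0 zs)) s)
                       (suc-injective (trans (sym (length-∷ʳ zs)) len)))
      evens)))
  ... | inj₁ pos with All.search odd? ys
  ...   | inj₁ evens = ∈-++⁺ˡ (∈-Dₑ⁺ (layered ys▷ pos s len)
                                     (All.map (decidable-stable (even? _)) evens))
  ...   | inj₂ odd   = ∈-++⁺ʳ (listing distinctEven? (suc m) n) (∈-++⁺ʳ evens∷ʳ0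
                         (∈-𝒫⁺ (layered ys▷ pos s len) odd))

  total : ∀ {xs} → xs ∈ sources → ∃ λ ys → ys ∈ targets × Matches n xs ys
  total xs∈ with ∈-++⁻ (listing 𝒫ᵉᵈₒd? (suc m) (suc n)) xs∈
  -- Having at least one part, a partition into distinct odd parts contains an odd part, so it lies
  -- in the last block of `targets`.
  ... | inj₂ ∈Dₒ with ly@(layered _ _ s len) , odds ← ∈-Dₒ⁻ ∈Dₒ =
    _ , ∈-++⁺ʳ (listing distinctEven? (suc m) n) (∈-++⁺ʳ evens∷ʳ0 (∈-𝒫⁺ ly (all⇒any len odds))) ,
    kept s odds
  ... | inj₁ ∈𝒫 with layered xs▷ _ s len , odd ← ∈-𝒫⁻ ∈𝒫
                 with ys , l , ys▷ ← lower xs▷ odd =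
    ys ,
    lowered∈targets ys▷ (suc-injective (trans (sym (lowers-sum l)) s))
                        (trans (sym (lowers-length l)) len) ,
    lowered s l

  raised : ∀ {ys} → AllPairs _▷_ ys → sum ys ≡ n → length ys ≡ suc m → Any Even ys →
           ∃ λ xs → xs ∈ sources × Matches n xs ys
  raised ys▷ s len even with xs , l , xs▷ ← raise ys▷ even =
    xs ,
    ∈-++⁺ˡ (∈-𝒫⁺ (layered xs▷ (anyOdd⇒positive xs▷ odd) s′ (trans (lowers-length l) len)) odd) ,
    lowered s′ l
    where
    odd = lowers⇒anyOdd l
    s′  = trans (lowers-sum l) (cong suc s)

  surjective : ∀ {ys} → ys ∈ targets → ∃ λ xs → xs ∈ sources × Matches n xs ys
  surjective ys∈ with ∈-++⁻ (listing distinctEven? (suc m) n) ys∈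
  ... | inj₁ ∈Dₑ with layered ys▷ _ s len , evens ← ∈-Dₑ⁻ ∈Dₑ =
    raised ys▷ s len (all⇒any len evens)
  ... | inj₂ ys∈′ with ∈-++⁻ evens∷ʳ0 ys∈′
  ...   | inj₁ ∈₀ with zs , zs∈ , refl ← ∈-map⁻ (_∷ʳ 0) ∈₀
                  with layered zs▷ pos s len , evens ← ∈-Dₑ⁻ zs∈ =
    raised (∷ʳ0-▷ zs▷ pos evens) (trans (sum-∷ʳ0 zs) s) len′
           (all⇒any len′ (Allₚ.∷ʳ⁺ evens (2 ∣0)))
    where len′ = trans (length-∷ʳ zs) (cong suc len)
  surjective {ys} _ | inj₂ _ | inj₂ ∈𝒫
    with ly@(layered ys▷ _ s len) , _ ← ∈-𝒫⁻ ∈𝒫 with All.search even? ys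
  -- Without an even part there is nothing to raise, and the partition is matched with itself.
  ... | inj₁ odds = ys , ∈-++⁺ʳ (listing 𝒫ᵉᵈₒd? (suc m) (suc n)) (∈-Dₒ⁺ ly odds) , kept s odds
  ... | inj₂ even = raised ys▷ s len even

  -- From the bijection to the integer identity

  count-identity : pᵉᵈₒd (suc m) (suc n) ℕ.+ Dₒ (suc m) n ≡
                   Dₑ (suc m) n ℕ.+ (Dₑ m n ℕ.+ pᵉᵈₒd (suc m) n)
  count-identity = begin
    pᵉᵈₒd (suc m) (suc n) ℕ.+ Dₒ (suc m) n
      ≡⟨ length-++ (listing 𝒫ᵉᵈₒd? (suc m) (suc n)) ⟨
    length sources
      ≡⟨ bijectiveRelation⇒length≡ {R = Matches n} sources-unique targets-unique
           total surjective matches-injective matches-functional ⟩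
    length targets
      ≡⟨ length-++ (listing distinctEven? (suc m) n) ⟩
    Dₑ (suc m) n ℕ.+ length (evens∷ʳ0 ++ listing 𝒫ᵉᵈₒd? (suc m) n)
      ≡⟨ cong (Dₑ (suc m) n ℕ.+_) (length-++ evens∷ʳ0) ⟩
    Dₑ (suc m) n ℕ.+ (length evens∷ʳ0 ℕ.+ pᵉᵈₒd (suc m) n)
      ≡⟨ cong (λ k → Dₑ (suc m) n ℕ.+ (k ℕ.+ pᵉᵈₒd (suc m) n)) 
            (length-map (_∷ʳ 0) (listing distinctEven? m n)) ⟩
    Dₑ (suc m) n ℕ.+ (Dₑ m n ℕ.+ pᵉᵈₒd (suc m) n) ∎
    where open ≡-Reasoning

rearrange : ∀ a b c d e → a ℕ.+ c ≡ d ℕ.+ (e ℕ.+ b) → + a - + b ≡ + d + + e - + c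
rearrange a b c d e eq = begin
  + a - + b                         ≡⟨ expand (+ a) (+ b) (+ c) ⟩
  -- `+ a + + c` computes to `+ (a ℕ.+ c)`, so the identity of naturals applies directly.
  (+ a + + c) - (+ b + + c)         ≡⟨ cong (_- (+ b + + c)) (cong +_ eq) ⟩
  (+ d + (+ e + + b)) - (+ b + + c) ≡⟨ collapse (+ b) (+ c) (+ d) (+ e) ⟩
  + d + + e - + c                   ∎
  where
  open ≡-Reasoning
  expand : ∀ x y z → x - y ≡ (x + z) - (y + z)
  expand = solve-∀
  collapse : ∀ y z u v → (u + (v + y)) - (y + z) ≡ u + v - z
  collapse = solve-∀

mainTheorem4 : (m n : ℕ) → m ≥ 1 → n ≥ 1 →
    + pᵉᵈₒd m n - + pᵉᵈₒd m (n ∸ 1) ≡ + Dₑ m (n ∸ 1) + + Dₑ (m ∸ 1) (n ∸ 1) - + Dₒ m (n ∸ 1)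
mainTheorem4 (suc m) (suc n) _ _ =
  rearrange (pᵉᵈₒd (suc m) (suc n)) (pᵉᵈₒd (suc m) n) (Dₒ (suc m) n) (Dₑ (suc m) n) (Dₑ m n)
            (count-identity m n)
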